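{- Let $t\geqslant 2$ be an integer, let $r\in\{2t,2t+1\}$, and let $n\geqslant 2r$. Then $$N(n,2r,r)=\begin{cases}\binom{2t}{t}, & \text{if } r=2t,\\[2pt] 2\binom{2t-2}{t-1}, & \text{if } r=2t+1.\end{cases}$$
   Context: $\mathrm{Sym}_n$ denotes the symmetric group of permutations of $[n]=\{1,\dots,n\}$ ($n\geqslant 2$). The Hamming distance between $\pi,\tau\in\mathrm{Sym}_n$ is $d(\pi,\tau)=|\{i\in[n]:\pi(i)\neq\tau(i)\}|$. For $\pi\in\mathrm{Sym}_n$ and an integer $r$, $B_r(\pi)=\{\tau\in\mathrm{Sym}_n: d(\pi,\tau)\leqslant r\}$. For integers $d,r$, $N(n,d,r)=\max\{|B_r(\pi)\cap B_r(\tau)| : \pi,\tau\in\mathrm{Sym}_n,\ d(\pi,\tau)\geqslant d\}$. -}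

module Defs where

open import Data.Nat using (ℕ; zero; suc; _⊔_; _≤ᵇ_)
open import Data.Fin using (Fin)
open import Data.Fin.Properties using (_≟_)
open import Data.Vec using (Vec; []; _∷_; zipWith)
open import Data.Bool using (Bool; true; false; _∧_; not; if_then_else_)
open import Data.List using (List; []; _∷_; concatMap; map; filter; length; foldr; allFin; and)
open import Relation.Nullary.Decidable using (⌊_⌋)
open import Relation.Unary using (Decidable)
open import Data.Bool using (T)
open import Data.Bool.Properties using (T?)

-- A permutation of [n] is represented in one-line notation: the vector
-- (π(1), …, π(n)) of its values, with entries in Fin n, all distinct.

allVecs : (n m : ℕ) → List (Vec (Fin n) m)
allVecs n zero = [] ∷ []
allVecs n (suc m) = concatMap (λ v → map (λ x → x ∷ v) (allFin n)) (allVecs n m)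

notIn : ∀ {n m} → Fin n → Vec (Fin n) m → Bool
notIn x [] = true
notIn x (y ∷ v) = not ⌊ x ≟ y ⌋ ∧ notIn x v

distinct : ∀ {n m} → Vec (Fin n) m → Bool
distinct [] = true
distinct (x ∷ v) = notIn x v ∧ distinct v

Sym : (n : ℕ) → List (Vec (Fin n) n)
Sym n = filter (λ v → T? (distinct v)) (allVecs n n)

hamming : ∀ {n m} → Vec (Fin n) m → Vec (Fin n) m → ℕ
hamming [] [] = 0
hamming (x ∷ u) (y ∷ v) = (if ⌊ x ≟ y ⌋ then 0 else 1) Data.Nat.+ hamming u v

inBall : ∀ {n} → ℕ → Vec (Fin n) n → Vec (Fin n) n → Bool
inBall r π τ = hamming π τ ≤ᵇ r

ballInter : (n r : ℕ) → Vec (Fin n) n → Vec (Fin n) n → ℕ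
ballInter n r π τ = length (filter (λ σ → T? (inBall r π σ ∧ inBall r τ σ)) (Sym n))

-- N(n,d,r) = max { |B_r(π) ∩ B_r(τ)| : π,τ ∈ Sym_n, d(π,τ) ≥ d }
-- (max over the empty set is taken as 0; not relevant in the theorem since n ≥ 2r ≥ d
--  guarantees the set is nonempty)
N : (n d r : ℕ) → ℕ
N n d r = foldr _⊔_ 0
  (concatMap (λ π → map (λ τ → if d ≤ᵇ hamming π τ then ballInter n r π τ else 0) (Sym n)) (Sym n))

{-# OPTIONS --safe #-}

-- If d(π,τ) ≥ 2r, then every σ in both balls is at distance exactly r from π and from τ,
-- d(π,τ) = 2r, and σ(i) ∈ {π(i), τ(i)} for all i. If π(j) = τ(i) ≠ π(i), then σ follows τ at i
-- if and only if it does so at j. Hence the 2r positions where π and τ differ fall into blocks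
-- of size at least 2 on each of which σ follows π throughout or τ throughout, and the
-- intersection has at most as many elements as there are sets of blocks of total size r.
-- With k blocks the Littlewood–Offord theorem bounds this number by the central binomial
-- coefficient of row k, and k ≤ r; for odd r = 2t + 1 only k = 2t requires a closer look:
-- the block sizes are 3, 3, 2, …, 2 (or 4, 2, …, 2, where all sums are even).
-- Equality is attained by τ = π ∘ ρ with ρ a product of disjoint transpositions and,
-- for odd r, two 3-cycles.
module Submission where

open import Defs
open import Data.Nat
  using (ℕ; zero; suc; _+_; _*_; _∸_; _⊔_; _≤_; _<_; _>_; _≤?_; _≤ᵇ_; _≤′_; ≤′-refl; ≤′-step; z≤n; s≤s)
open import Data.Nat.Combinatorics using (_C_; nCk≡nC[n∸k]; nCn≡1; nCk+nC[k+1]≡[n+1]C[k+1])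
open import Data.Nat.Properties hiding (_≟_)
open import Algebra.Properties.CommutativeSemigroup +-commutativeSemigroup
  using (interchange; xy∙z≈xz∙y; x∙yz≈y∙xz)
open import Data.Bool using (Bool; true; false; T; not; if_then_else_; _∧_)
open import Data.Bool.Properties using (T-∧; T?) renaming (_≟_ to _≟ᵇ_)
open import Data.Fin using (Fin; zero; suc; punchOut; _↑ˡ_; _↑ʳ_; splitAt)
open import Data.Fin.Properties
  using (_≟_; any?; injective⇒≤; punchOut-injective; ↑ˡ-injective; ↑ʳ-injective;
         splitAt-↑ˡ; splitAt-↑ʳ; splitAt⁻¹-↑ˡ; splitAt⁻¹-↑ʳ)
open import Data.List
  using (List; []; _∷_; _++_; length; map; replicate; concat; filter; allFin; foldr)
open import Data.List.Properties using (length-replicate; length-++; length-map; map-++)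
open import Data.List.Membership.Propositional using (_∈_)
open import Data.List.Membership.Propositional.Properties
  using (∈-++⁻; ∈-++⁺ˡ; ∈-++⁺ʳ; ∈-∃++; ∈-filter⁻; ∈-filter⁺;
         ∈-map⁺; ∈-map⁻; ∈-allFin; ∈-concatMap⁺; ∈-insert)
open import Data.List.Relation.Unary.Any as Any using (here; there)
open import Data.List.Relation.Unary.All as All using (All; []; _∷_)
open import Data.List.Relation.Unary.AllPairs as AllPairs using (AllPairs; []; _∷_)
open import Data.List.Relation.Unary.Unique.Propositional using (Unique)
open import Data.List.Relation.Binary.Permutation.Propositional
  using (_↭_; prep; swap; ↭-refl; ↭-trans; ↭-sym; ↭-reflexive)
open import Data.List.Relation.Binary.Permutation.Propositional.Properties
  using (↭-length; ∈-resp-↭; ++⁺ʳ; ++⁺ˡ; shift) renaming (map⁺ to ↭-map⁺)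
open import Data.Nat.ListAction using (sum)
open import Data.Nat.ListAction.Properties using (sum-++; sum-↭)
open import Data.Product using (∃; _×_; _,_; proj₁; proj₂)
open import Data.Sum using (_⊎_; inj₁; inj₂; [_,_]′)
open import Data.Vec as Vec using (Vec; []; _∷_; lookup; tabulate)
open import Data.Vec.Properties
  using (tabulate∘lookup; tabulate-cong; ∷-injective; ++-injective;
         lookup-map; lookup-++ˡ; lookup-++ʳ; lookup-allFin)
open import Function using (_∘_; id; Equivalence)
open import Function.Definitions using (Injective)
open import Relation.Nullary using (¬_; yes; no; contradiction)
open import Relation.Nullary.Decidable using (⌊_⌋)
open import Relation.Binary.PropositionalEquality
import Data.Fin.Properties as Fin
import Data.List.Properties as List
import Data.List.Relation.Unary.All.Properties as All
import Data.List.Relation.Unary.AllPairs.Properties as AllPairs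
import Data.List.Relation.Unary.Unique.Propositional.Properties as Unique
import Data.List.Relation.Binary.Permutation.Propositional as ↭

private variable
  n m a : ℕ

n*2≡n+n : ∀ n → n * 2 ≡ n + n
n*2≡n+n n = trans (*-comm n 2) (cong (n +_) (+-identityʳ n))

-- Subset sums

-- On generating functions this is multiplication by x^a. Recursion on both numbers, in place of
-- truncated subtraction, yields the value 0 for s < a.
delay : ℕ → (ℕ → ℕ) → ℕ → ℕ
delay zero    g s       = g s
delay (suc a) g zero    = 0
delay (suc a) g (suc s) = delay a g s

-- The coefficient of x^s in the product of the factors 1 + x^a, a ∈ L.
subsetSums : List ℕ → ℕ → ℕ
subsetSums []      zero    = 1
subsetSums []      (suc s) = 0
subsetSums (a ∷ L) s       = subsetSums L s + delay a (subsetSums L) s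

delay-+ : ∀ a g s → delay a g (a + s) ≡ g s
delay-+ zero    g s = refl
delay-+ (suc a) g s = delay-+ a g s

delay-< : ∀ a g s → s < a → delay a g s ≡ 0
delay-< (suc a) g zero    _         = refl
delay-< (suc a) g (suc s) (s≤s s<a) = delay-< a g s s<a

delay-cong : ∀ a {g h} → (∀ s → g s ≡ h s) → ∀ s → delay a g s ≡ delay a h s
delay-cong zero    g≗h s       = g≗h s
delay-cong (suc a) g≗h zero    = refl
delay-cong (suc a) g≗h (suc s) = delay-cong a g≗h s

delay-distrib-+ : ∀ a g h s → delay a (λ u → g u + h u) s ≡ delay a g s + delay a h s
delay-distrib-+ zero    g h s       = refl
delay-distrib-+ (suc a) g h zero    = refl
delay-distrib-+ (suc a) g h (suc s) = delay-distrib-+ a g h s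

delay-suc : ∀ a g s → delay a (delay 1 g) s ≡ delay (suc a) g s
delay-suc zero    g s       = refl
delay-suc (suc a) g zero    = refl
delay-suc (suc a) g (suc s) = delay-suc a g s

-- Induction on `b` for all `a` at once: one factor x at a time passes from the inner delay to the
-- outer one, hence the exponent `b + a`.
delay-delay : ∀ a b g s → delay a (delay b g) s ≡ delay (b + a) g s
delay-delay a zero    g s = refl
delay-delay a (suc b) g s = begin
  delay a (delay (suc b) g) s        ≡⟨ delay-cong a (λ u → sym (delay-1-suc b u)) s ⟩
  delay a (delay 1 (delay b g)) s    ≡⟨ delay-suc a (delay b g) s ⟩
  delay (suc a) (delay b g) s        ≡⟨ delay-delay (suc a) b g s ⟩
  delay (b + suc a) g s              ≡⟨ cong (λ e → delay e g s) (+-suc b a) ⟩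
  delay (suc b + a) g s              ∎
  where
  open ≡-Reasoning
  delay-1-suc : ∀ b u → delay 1 (delay b g) u ≡ delay (suc b) g u
  delay-1-suc b zero    = refl
  delay-1-suc b (suc u) = refl

delay-comm : ∀ a b g s → delay a (delay b g) s ≡ delay b (delay a g) s
delay-comm a b g s = begin
  delay a (delay b g) s  ≡⟨ delay-delay a b g s ⟩
  delay (b + a) g s      ≡⟨ cong (λ e → delay e g s) (+-comm b a) ⟩
  delay (a + b) g s      ≡⟨ delay-delay b a g s ⟨
  delay b (delay a g) s  ∎
  where open ≡-Reasoning

subsetSums-∷ : ∀ a L M → (∀ s → subsetSums L s ≡ subsetSums M s) →
               ∀ s → subsetSums (a ∷ L) s ≡ subsetSums (a ∷ M) s
subsetSums-∷ a L M L≗M s = cong₂ _+_ (L≗M s) (delay-cong a L≗M s)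

-- The factors 1 + x^a commute. For a swap, both sides expand to the four terms of (1 + x^a)(1 +
-- x^b) times the generating function of the tail.
subsetSums-↭ : ∀ {L M} → L ↭ M → ∀ s → subsetSums L s ≡ subsetSums M s
subsetSums-↭ ↭.refl s = refl
subsetSums-↭ {_ ∷ L} {_ ∷ M} (prep a p) s = subsetSums-∷ a L M (subsetSums-↭ p) s
subsetSums-↭ (↭.trans p q) s = trans (subsetSums-↭ p s) (subsetSums-↭ q s)
subsetSums-↭ {a ∷ b ∷ L} {_ ∷ _ ∷ M} (swap a b p) s = begin
  (f s + delay b f s) + delay a (λ u → f u + delay b f u) s
    ≡⟨ cong ((f s + delay b f s) +_) (delay-distrib-+ a f (delay b f) s) ⟩
  (f s + delay b f s) + (delay a f s + delay a (delay b f) s)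
    ≡⟨ cong (λ e → (f s + delay b f s) + (delay a f s + e)) (delay-comm a b f s) ⟩
  (f s + delay b f s) + (delay a f s + delay b (delay a f) s)
    ≡⟨ interchange (f s) (delay b f s) (delay a f s) _ ⟩
  (f s + delay a f s) + (delay b f s + delay b (delay a f) s)
    ≡⟨ cong ((f s + delay a f s) +_) (delay-distrib-+ b f (delay a f) s) ⟨
  subsetSums (b ∷ a ∷ L) s
    ≡⟨ subsetSums-∷ b (a ∷ L) (a ∷ M) (subsetSums-∷ a L M (subsetSums-↭ p)) s ⟩
  subsetSums (b ∷ a ∷ M) s ∎
  where
  open ≡-Reasoning
  f = subsetSums L

-- The Littlewood–Offord bound

below : ℕ → List ℕ → List ℕ
below a []      = []
below a (t ∷ T) with a ≤? t
... | yes _ = t ∸ a ∷ below a T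
... | no  _ = below a T

∈-below⁻ : ∀ a T {u} → u ∈ below a T → a + u ∈ T
∈-below⁻ a (t ∷ T) u∈ with a ≤? t
∈-below⁻ a (t ∷ T) (here refl) | yes a≤t = here (m+[n∸m]≡n a≤t)
∈-below⁻ a (t ∷ T) (there u∈)  | yes _   = there (∈-below⁻ a T u∈)
∈-below⁻ a (t ∷ T) u∈          | no  _   = there (∈-below⁻ a T u∈)

length-below : ∀ a T → length (below a T) ≤ length T
length-below a []      = z≤n
length-below a (t ∷ T) with a ≤? t
... | yes _ = s≤s (length-below a T)
... | no  _ = m≤n⇒m≤1+n (length-below a T)

below-decreasing : ∀ a {T} → AllPairs _>_ T → AllPairs _>_ (below a T)
below-decreasing a {[]}    []        = []
below-decreasing a {t ∷ T} (t> ∷ T↓) with a ≤? t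
... | no  _   = below-decreasing a T↓
... | yes a≤t = All.tabulate (λ u∈ → below-head (All.lookup t> (∈-below⁻ a T u∈)))
              ∷ below-decreasing a T↓
  where
  below-head : ∀ {u} → a + u < t → u < t ∸ a
  below-head {u} a+u<t = +-cancelˡ-< a u (t ∸ a) (subst (a + u <_) (sym (m+[n∸m]≡n a≤t)) a+u<t)

-- Selections that contain `a` and meet a target in `T` are counted as selections of the rest with
-- target in T - a; a target smaller than `a` contributes 0 on the left and is dropped on the right.
sum-delay : ∀ a g T → sum (map (delay a g) T) ≡ sum (map g (below a T))
sum-delay a g []      = refl
sum-delay a g (t ∷ T) with a ≤? t
... | yes a≤t = cong₂ _+_
  (trans (cong (delay a g) (sym (m+[n∸m]≡n a≤t))) (delay-+ a g (t ∸ a))) (sum-delay a g T)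
... | no  a≰t = cong₂ _+_ (delay-< a g t (≰⇒> a≰t)) (sum-delay a g T)

sum-map-+ : ∀ (g h : ℕ → ℕ) T →
            sum (map (λ t → g t + h t) T) ≡ sum (map g T) + sum (map h T)
sum-map-+ g h []      = refl
sum-map-+ g h (t ∷ T) = begin
  (g t + h t) + sum (map (λ t → g t + h t) T)   ≡⟨ cong ((g t + h t) +_) (sum-map-+ g h T) ⟩
  (g t + h t) + (sum (map g T) + sum (map h T)) ≡⟨ interchange (g t) (h t) _ _ ⟩
  (g t + sum (map g T)) + (h t + sum (map h T)) ∎
  where open ≡-Reasoning

-- The sum of the m largest binomial coefficients in row k.
middle : ℕ → ℕ → ℕ
middle k       zero    = 0
middle zero    (suc m) = 1
middle (suc k) (suc m) = middle k (suc (suc m)) + middle k m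

middle-monoʳ : ∀ k {m m′} → m ≤ m′ → middle k m ≤ middle k m′
middle-monoʳ k       z≤n       = z≤n
middle-monoʳ zero    (s≤s _)   = ≤-refl
middle-monoʳ (suc k) (s≤s m≤n) =
  +-mono-≤ (middle-monoʳ k (s≤s (s≤s m≤n))) (middle-monoʳ k m≤n)

middle-stepˡ : ∀ k m → middle k m ≤ middle (suc k) m
middle-stepˡ k zero    = ≤-refl
middle-stepˡ k (suc m) = ≤-trans (middle-monoʳ k (n≤1+n (suc m))) (m≤m+n _ _)

middle-monoˡ : ∀ {k k′} m → k ≤ k′ → middle k m ≤ middle k′ m
middle-monoˡ m k≤k′ = go (≤⇒≤′ k≤k′)
  where
  go : ∀ {k k′} → k ≤′ k′ → middle k m ≤ middle k′ m
  go ≤′-refl      = ≤-refl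
  go (≤′-step k≤) = ≤-trans (go k≤) (middle-stepˡ _ m)

-- Kleitman's argument: the targets of the selections without and with the head a
-- are T and T ∸ a; moving max T, which is not in T ∸ a, from the former to the latter
-- leaves two sets of targets of sizes |T| − 1 and at most |T| + 1.
subsetSums-≤-middle : ∀ {L} → All (1 ≤_) L → ∀ {T} → AllPairs _>_ T →
                      sum (map (subsetSums L) T) ≤ middle (length L) (length T)
subsetSums-≤-middle L>0 [] = z≤n
subsetSums-≤-middle {[]} [] {zero  ∷ []}    _                  = ≤-refl
subsetSums-≤-middle {[]} [] {zero  ∷ _ ∷ _} ((() ∷ _) ∷ _)
subsetSums-≤-middle {[]} [] {suc t ∷ T}     (_ ∷ T↓)           =
  ≤-trans (subsetSums-≤-middle [] T↓) (middle-monoʳ 0 (n≤1+n (length T)))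
subsetSums-≤-middle {a ∷ L} (a>0 ∷ L>0) {t ∷ T} tT↓@(t> ∷ T↓) = begin
  sum (map (subsetSums (a ∷ L)) (t ∷ T))
    ≡⟨ sum-map-+ f (delay a f) (t ∷ T) ⟩
  (f t + sum (map f T)) + sum (map (delay a f) (t ∷ T))
    ≡⟨ cong ((f t + sum (map f T)) +_) (sum-delay a f (t ∷ T)) ⟩
  (f t + sum (map f T)) + sum (map f T′)
    ≡⟨ xy∙z≈xz∙y (f t) _ _ ⟩
  sum (map f (t ∷ T′)) + sum (map f T)
    ≤⟨ +-mono-≤ (subsetSums-≤-middle L>0 (t>T′ ∷ below-decreasing a tT↓))
                (subsetSums-≤-middle L>0 T↓) ⟩
  middle (length L) (suc (length T′)) + middle (length L) (length T)
    ≤⟨ +-monoˡ-≤ _ (middle-monoʳ (length L) (s≤s (length-below a (t ∷ T)))) ⟩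
  middle (length (a ∷ L)) (length (t ∷ T)) ∎
  where
  open ≤-Reasoning
  f  = subsetSums L
  T′ = below a (t ∷ T)
  ≤t : ∀ {u} → u ∈ t ∷ T → u ≤ t
  ≤t (here refl) = ≤-refl
  ≤t (there u∈)  = <⇒≤ (All.lookup t> u∈)
  t>T′ : All (t >_) T′
  t>T′ = All.tabulate λ {u} u∈ →
    ≤-trans (+-monoˡ-≤ u a>0) (≤t (∈-below⁻ a (t ∷ T) u∈))

-- Consecutive binomial coefficients

nC0≡1 : ∀ n → n C 0 ≡ 1
nC0≡1 n = trans (nCk≡nC[n∸k] {0} {n} z≤n) (nCn≡1 n)

binomSum : ℕ → ℕ → ℕ → ℕ
binomSum k a zero    = 0
binomSum k a (suc m) = k C a + binomSum k (suc a) m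

binomSum-pascal : ∀ k a m →
                  binomSum (suc k) (suc a) m ≡ binomSum k a m + binomSum k (suc a) m
binomSum-pascal k a zero    = refl
binomSum-pascal k a (suc m) = begin
  suc k C suc a + binomSum (suc k) (suc (suc a)) m
    ≡⟨ cong₂ _+_ (sym (nCk+nC[k+1]≡[n+1]C[k+1] k a)) (binomSum-pascal k (suc a) m) ⟩
  (k C a + k C suc a) + (binomSum k (suc a) m + binomSum k (suc (suc a)) m)
    ≡⟨ interchange (k C a) (k C suc a) _ _ ⟩
  binomSum k a (suc m) + binomSum k (suc a) (suc m) ∎
  where open ≡-Reasoning

-- Since k < m, the window on the right covers all of row k, and no choice of entries of the row
-- exceeds their total. In the induction column 0, where Pascal's rule has no left neighbour, is
-- split off; its entry is 1 in every row.
middle-≤-row : ∀ k m′ {m} → k < m → middle k m′ ≤ binomSum k 0 m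
middle-≤-row k       zero     _                   = z≤n
middle-≤-row zero    (suc m′) {suc m} _           = s≤s z≤n
middle-≤-row (suc k) (suc m′) {suc m} (s≤s k<m)   = begin
  middle k (suc (suc m′)) + middle k m′
    ≤⟨ +-mono-≤ (middle-≤-row k (suc (suc m′)) k<m) (middle-≤-row k m′ (m<n⇒m<1+n k<m)) ⟩
  binomSum k 0 m + (k C 0 + binomSum k 1 m)
    ≡⟨ cong (λ e → binomSum k 0 m + (e + binomSum k 1 m)) (trans (nC0≡1 k) (sym (nC0≡1 (suc k)))) ⟩
  binomSum k 0 m + (suc k C 0 + binomSum k 1 m)
    ≡⟨ x∙yz≈y∙xz (binomSum k 0 m) (suc k C 0) _ ⟩
  suc k C 0 + (binomSum k 0 m + binomSum k 1 m)
    ≡⟨ cong (suc k C 0 +_) (binomSum-pascal k 0 m) ⟨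
  binomSum (suc k) 0 (suc m) ∎
  where open ≤-Reasoning

-- The equation says that the columns a, ..., a + m - 1 lie symmetrically in row k. Pascal's rule
-- turns such a window into two symmetric windows of the row before, of lengths m + 1 and m - 1,
-- which is the recursion of `middle`. A window that starts in column 0 is the whole row.
middle-≤-binomSum : ∀ k a m → a * 2 + m ≡ suc k → middle k m ≤ binomSum k a m
middle-≤-binomSum k       a       zero          _    = z≤n
middle-≤-binomSum k       zero    (suc m)       refl = middle-≤-row k (suc m) ≤-refl
middle-≤-binomSum zero    (suc a) (suc m)       ()
middle-≤-binomSum (suc k) (suc a) (suc m)       eq   = begin
  middle k (suc (suc m)) + middle k m
    ≤⟨ +-mono-≤ (middle-≤-binomSum k a (suc (suc m)) (trans (+-suc (a * 2) (suc m)) eq₁))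
                (middle-≤-binomSum k (suc a) m (trans (cong suc (sym (+-suc (a * 2) m))) eq₁)) ⟩
  (k C a + binomSum k (suc a) (suc m)) + binomSum k (suc a) m
    ≡⟨ xy∙z≈xz∙y (k C a) _ _ ⟩
  binomSum k a (suc m) + binomSum k (suc a) (suc m)
    ≡⟨ binomSum-pascal k a (suc m) ⟨
  binomSum (suc k) (suc a) (suc m) ∎
  where
  open ≤-Reasoning
  eq₁ : suc (a * 2 + suc m) ≡ suc k
  eq₁ = suc-injective eq

-- The case of a single target. Lists shorter than 2t are covered because `middle` grows with the
-- row, and the largest entry of row 2t is the central one.
subsetSums-≤-central : ∀ {L} → All (1 ≤_) L → ∀ t → length L ≤ t * 2 →
                       ∀ s → subsetSums L s ≤ (t * 2) C t
subsetSums-≤-central {L} L>0 t k≤2t s = begin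
  subsetSums L s                ≡⟨ +-identityʳ _ ⟨
  sum (map (subsetSums L) (s ∷ []))  ≤⟨ subsetSums-≤-middle L>0 ([] ∷ []) ⟩
  middle (length L) 1           ≤⟨ middle-monoˡ 1 k≤2t ⟩
  middle (t * 2) 1              ≤⟨ middle-≤-binomSum (t * 2) t 1 (+-comm (t * 2) 1) ⟩
  (t * 2) C t + 0               ≡⟨ +-identityʳ _ ⟩
  (t * 2) C t                   ∎
  where open ≤-Reasoning

-- Lists of weights at least two with small excess

length*2≤sum : ∀ {L} → All (2 ≤_) L → length L * 2 ≤ sum L
length*2≤sum []           = z≤n
length*2≤sum (2≤a ∷ 2≤L) = +-mono-≤ 2≤a (length*2≤sum 2≤L)

-- The excess of a list is its sum minus twice its length. An entry above 2 would leave the tail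
-- with a sum below twice its length.
excess-0 : ∀ {L} → All (2 ≤_) L → sum L ≡ length L * 2 → L ≡ replicate (length L) 2
excess-0 [] _ = refl
excess-0 {suc (suc zero) ∷ L} (_ ∷ 2≤L) eq =
  cong (2 ∷_) (excess-0 2≤L (suc-injective (suc-injective eq)))
excess-0 {suc (suc (suc x)) ∷ L} (_ ∷ 2≤L) eq = contradiction
  (≤-trans (length*2≤sum 2≤L) (m≤n+m (sum L) x))
  (<⇒≱ (≤-reflexive (suc-injective (suc-injective eq))))
excess-0 {suc zero ∷ L} (s≤s () ∷ _) _

-- A single surplus unit turns one entry into 3. Its place is unknown, so the shape is given up to
-- permutation.
excess-1 : ∀ {L} → All (2 ≤_) L → sum L ≡ 1 + length L * 2 →
           ∃ λ k → L ↭ 3 ∷ replicate k 2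
excess-1 {suc zero ∷ L} (s≤s () ∷ _) _
excess-1 {suc (suc zero) ∷ L} (_ ∷ 2≤L) eq =
  let k , p = excess-1 2≤L (suc-injective (suc-injective eq))
  in suc k , ↭-trans (prep 2 p) (swap 2 3 ↭-refl)
excess-1 {suc (suc (suc zero)) ∷ L} (_ ∷ 2≤L) eq =
  length L , subst (λ M → 3 ∷ L ↭ 3 ∷ M) (excess-0 2≤L (suc-injective (suc-injective (suc-injective eq)))) ↭-refl
excess-1 {suc (suc (suc (suc x))) ∷ L} (_ ∷ 2≤L) eq = contradiction
  (≤-trans (length*2≤sum 2≤L) (m≤n+m (sum L) x))
  (<⇒≱ (≤-reflexive (suc-injective (suc-injective (suc-injective eq)))))

-- The two surplus units fall on the same entry or on two different ones.
excess-2 : ∀ {L} → All (2 ≤_) L → sum L ≡ 2 + length L * 2 →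
           (∃ λ k → L ↭ 4 ∷ replicate k 2) ⊎ (∃ λ k → L ↭ 3 ∷ 3 ∷ replicate k 2)
excess-2 {suc zero ∷ L} (s≤s () ∷ _) _
excess-2 {suc (suc zero) ∷ L} (_ ∷ 2≤L) eq
  with excess-2 2≤L (suc-injective (suc-injective eq))
... | inj₁ (k , p) = inj₁ (suc k , ↭-trans (prep 2 p) (swap 2 4 ↭-refl))
... | inj₂ (k , p) = inj₂ (suc k , ↭-trans (prep 2 p)
                       (↭-trans (swap 2 3 ↭-refl) (prep 3 (swap 2 3 ↭-refl))))
excess-2 {suc (suc (suc zero)) ∷ L} (_ ∷ 2≤L) eq =
  let k , p = excess-1 2≤L (suc-injective (suc-injective (suc-injective eq)))
  in inj₂ (k , prep 3 p)
excess-2 {suc (suc (suc (suc zero))) ∷ L} (_ ∷ 2≤L) eq =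
  inj₁ (length L , subst (λ M → 4 ∷ L ↭ 4 ∷ M)
    (excess-0 2≤L (suc-injective (suc-injective (suc-injective (suc-injective eq))))) ↭-refl)
excess-2 {suc (suc (suc (suc (suc x)))) ∷ L} (_ ∷ 2≤L) eq = contradiction
  (≤-trans (length*2≤sum 2≤L) (m≤n+m (sum L) x))
  (<⇒≱ (≤-reflexive (suc-injective (suc-injective (suc-injective (suc-injective eq))))))

subsetSums-twos-odd : ∀ k j → subsetSums (replicate k 2) (1 + j * 2) ≡ 0
subsetSums-twos-odd zero    j       = refl
subsetSums-twos-odd (suc k) zero    = trans (+-identityʳ _) (subsetSums-twos-odd k 0)
subsetSums-twos-odd (suc k) (suc j) =
  cong₂ _+_ (subsetSums-twos-odd k (suc j)) (subsetSums-twos-odd k j)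

subsetSums-twos-even : ∀ k j → subsetSums (replicate k 2) (j * 2) ≡ k C j
subsetSums-twos-even zero    zero    = refl
subsetSums-twos-even zero    (suc j) = refl
subsetSums-twos-even (suc k) zero    =
  trans (+-identityʳ _) (trans (subsetSums-twos-even k 0) (trans (nC0≡1 k) (sym (nC0≡1 (suc k)))))
subsetSums-twos-even (suc k) (suc j) = begin
  subsetSums (replicate k 2) (suc j * 2) + subsetSums (replicate k 2) (j * 2)
    ≡⟨ cong₂ _+_ (subsetSums-twos-even k (suc j)) (subsetSums-twos-even k j) ⟩
  k C suc j + k C j  ≡⟨ +-comm (k C suc j) (k C j) ⟩
  k C j + k C suc j  ≡⟨ nCk+nC[k+1]≡[n+1]C[k+1] k j ⟩
  suc k C suc j      ∎
  where open ≡-Reasoning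

subsetSums-four-twos-odd : ∀ k j → subsetSums (4 ∷ replicate k 2) (1 + j * 2) ≡ 0
subsetSums-four-twos-odd k zero          = trans (+-identityʳ _) (subsetSums-twos-odd k 0)
subsetSums-four-twos-odd k (suc zero)    = trans (+-identityʳ _) (subsetSums-twos-odd k 1)
subsetSums-four-twos-odd k (suc (suc j)) =
  cong₂ _+_ (subsetSums-twos-odd k (suc (suc j))) (subsetSums-twos-odd k j)

-- An odd sum 2j + 5 takes exactly one of the two threes, and j + 1 twos make up the rest. Taking
-- both threes would leave 2j - 1, which is odd, or negative when j = 0.
subsetSums-threes-twos-odd : ∀ k j →
  subsetSums (3 ∷ 3 ∷ replicate k 2) (1 + suc (suc j) * 2) ≡ 2 * (k C suc j)
subsetSums-threes-twos-odd k j = begin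
  (f (5 + j * 2) + f (suc j * 2)) + (f (suc j * 2) + delay 3 f (suc j * 2))
    ≡⟨ cong₂ _+_ (cong₂ _+_ (subsetSums-twos-odd k (suc (suc j))) (subsetSums-twos-even k (suc j)))
                 (cong₂ _+_ (subsetSums-twos-even k (suc j)) (odd-vanishes j)) ⟩
  (0 + k C suc j) + (k C suc j + 0) ≡⟨⟩
  2 * (k C suc j) ∎
  where
  open ≡-Reasoning
  f = subsetSums (replicate k 2)
  odd-vanishes : ∀ j → delay 3 f (suc j * 2) ≡ 0
  odd-vanishes zero    = refl
  odd-vanishes (suc j) = subsetSums-twos-odd k j

-- Weights of at least 2 with sum 4t number at most 2t, so the central bound applies.
subsetSums-≤-even : ∀ t {L} → All (2 ≤_) L → sum L ≡ (t * 2) * 2 → ∀ s →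
                    subsetSums L s ≤ (t * 2) C t
subsetSums-≤-even t {L} 2≤L eq =
  subsetSums-≤-central (All.map (≤-trans (s≤s z≤n)) 2≤L) t
    (*-cancelʳ-≤ (length L) (t * 2) 2 (≤-trans (length*2≤sum 2≤L) (≤-reflexive eq)))

-- Written with u = t − 2.
subsetSums-≤-odd : ∀ u {L} → All (2 ≤_) L → sum L ≡ (1 + suc (suc u) * 2) * 2 →
                   subsetSums L (1 + suc (suc u) * 2) ≤ 2 * ((suc u * 2) C suc u)
subsetSums-≤-odd u {L} 2≤L eq
  with m≤n⇒m<n∨m≡n (*-cancelʳ-≤ (length L) (5 + u * 2) 2
                     (≤-trans (length*2≤sum 2≤L) (≤-reflexive eq)))
-- With r weights of total 2r every weight is 2, and the odd target r is never reached.
... | inj₂ k≡ = ≤-trans (≤-reflexive (trans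
        (cong (λ M → subsetSums M (5 + u * 2)) (excess-0 2≤L (trans eq (cong (_* 2) (sym k≡)))))
        (subsetSums-twos-odd (length L) (suc (suc u))))) z≤n
... | inj₁ (s≤s k≤) with m≤n⇒m<n∨m≡n k≤
-- At most 2t - 1 weights: once the first is split off, at most 2t - 2 remain, and the central bound
-- applies both to the selections without it and to those with it.
...   | inj₁ (s≤s k≤) = few 2≤L k≤
  where
  few : ∀ {L} → All (2 ≤_) L → length L ≤ 3 + u * 2 →
        subsetSums L (5 + u * 2) ≤ 2 * ((suc u * 2) C suc u)
  few []                _        = z≤n
  few {a ∷ L} (2≤a ∷ 2≤L) (s≤s k≤) = +-mono-≤ (central (5 + u * 2))
    (≤-trans (delayed a (5 + u * 2)) (≤-reflexive (sym (+-identityʳ _))))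
    where
    central : ∀ s → subsetSums L s ≤ (suc u * 2) C suc u
    central = subsetSums-≤-central (All.map (≤-trans (s≤s z≤n)) 2≤L) (suc u) k≤
    delayed : ∀ a s → delay a (subsetSums L) s ≤ (suc u * 2) C suc u
    delayed zero    s       = central s
    delayed (suc a) zero    = z≤n
    delayed (suc a) (suc s) = delayed a s
-- Exactly 2t weights of total 2(2t + 1) have excess 2.
...   | inj₂ k≡ with excess-2 2≤L (trans eq (cong (λ k → 2 + k * 2) (sym k≡)))
...     | inj₁ (k , p) = ≤-trans (≤-reflexive
            (trans (subsetSums-↭ p (5 + u * 2)) (subsetSums-four-twos-odd k (suc (suc u))))) z≤n
...     | inj₂ (k , p) = ≤-reflexive (begin
  subsetSums L (5 + u * 2)                      ≡⟨ subsetSums-↭ p (5 + u * 2) ⟩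
  subsetSums (3 ∷ 3 ∷ replicate k 2) (5 + u * 2) ≡⟨ subsetSums-threes-twos-odd k u ⟩
  2 * (k C suc u)                               ≡⟨ cong (λ k → 2 * (k C suc u)) k≡′ ⟩
  2 * ((suc u * 2) C suc u)                     ∎)
  where
  open ≡-Reasoning
  k≡′ : k ≡ suc u * 2
  k≡′ = suc-injective (suc-injective (begin
    2 + k                              ≡⟨ cong (2 +_) (sym (length-replicate k)) ⟩
    2 + length (replicate k 2)         ≡⟨ ↭-length p ⟨
    length L                           ≡⟨ k≡ ⟩
    4 + u * 2                          ∎))

-- Permutations in one-line notation

notIn⁻ : ∀ (x : Fin n) (v : Vec (Fin n) m) → T (notIn x v) → ∀ i → x ≢ lookup v i
notIn⁻ x (y ∷ v) x∉ i with x ≟ y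
notIn⁻ x (y ∷ v) x∉ zero    | no x≢y = x≢y
notIn⁻ x (y ∷ v) x∉ (suc i) | no x≢y = notIn⁻ x v x∉ i

notIn⁺ : ∀ (x : Fin n) (v : Vec (Fin n) m) → (∀ i → x ≢ lookup v i) → T (notIn x v)
notIn⁺ x []      x∉ = _
notIn⁺ x (y ∷ v) x∉ with x ≟ y
... | yes x≡y = x∉ zero x≡y
... | no  _   = notIn⁺ x v (x∉ ∘ suc)

distinct⁻ : ∀ (v : Vec (Fin n) m) → T (distinct v) → Injective _≡_ _≡_ (lookup v)
distinct⁻ (x ∷ v) d {zero}  {zero}  eq = refl
distinct⁻ (x ∷ v) d {zero}  {suc j} eq =
  contradiction eq (notIn⁻ x v (proj₁ (Equivalence.to T-∧ d)) j)
distinct⁻ (x ∷ v) d {suc i} {zero}  eq =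
  contradiction (sym eq) (notIn⁻ x v (proj₁ (Equivalence.to T-∧ d)) i)
distinct⁻ (x ∷ v) d {suc i} {suc j} eq =
  cong suc (distinct⁻ v (proj₂ (Equivalence.to (T-∧ {notIn x v}) d)) eq)

distinct⁺ : ∀ (v : Vec (Fin n) m) → Injective _≡_ _≡_ (lookup v) → T (distinct v)
distinct⁺ []      inj = _
distinct⁺ (x ∷ v) inj = Equivalence.from T-∧
  ( notIn⁺ x v (λ i eq → contradiction (inj {zero} {suc i} eq) λ ())
  , distinct⁺ v (λ eq → Fin.suc-injective (inj eq)) )

-- Pigeonhole: if `y` were missed, punching it out would inject `Fin (suc n)` into `Fin n`.
injective⇒surjective : ∀ {f : Fin n → Fin n} → Injective _≡_ _≡_ f → ∀ y → ∃ λ i → f i ≡ y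
injective⇒surjective {suc n} {f} inj y with any? (λ i → f i ≟ y)
... | yes hit = hit
... | no miss = contradiction (injective⇒≤ {f = g} g-injective) 1+n≰n
  where
  y≢f : ∀ i → y ≢ f i
  y≢f i y≡fi = miss (i , sym y≡fi)
  g : Fin (suc n) → Fin n
  g i = punchOut (y≢f i)
  g-injective : Injective _≡_ _≡_ g
  g-injective {i} {j} = inj ∘ punchOut-injective (y≢f i) (y≢f j)

lookup-ext : ∀ {A : Set} {u v : Vec A m} → (∀ i → lookup u i ≡ lookup v i) → u ≡ v
lookup-ext {u = u} {v} eq = begin
  u                   ≡⟨ tabulate∘lookup u ⟨
  tabulate (lookup u) ≡⟨ tabulate-cong eq ⟩
  tabulate (lookup v) ≡⟨ tabulate∘lookup v ⟩
  v                   ∎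
  where open ≡-Reasoning

∈-allVecs : ∀ (v : Vec (Fin n) m) → v ∈ allVecs n m
∈-allVecs []      = here refl
∈-allVecs {n} (x ∷ v) = ∈-concatMap⁺ (λ v → map (_∷ v) (allFin n))
  (Any.map (λ { refl → ∈-map⁺ (_∷ v) (∈-allFin x) }) (∈-allVecs v))

allVecs-unique : ∀ n m → Unique (allVecs n m)
allVecs-unique n zero    = [] ∷ []
allVecs-unique n (suc m) = Unique.concat⁺
  (All.map⁺ (All.universal (λ v → Unique.map⁺ (proj₁ ∘ ∷-injective) (Unique.allFin⁺ n)) (allVecs n m)))
  (AllPairs.map⁺ (AllPairs.map disjoint (allVecs-unique n m)))
  where
  disjoint : ∀ {u v : Vec (Fin n) m} → u ≢ v → ∀ {w} →
             ¬ (w ∈ map (_∷ u) (allFin n) × w ∈ map (_∷ v) (allFin n))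
  disjoint u≢v (p , q) with ∈-map⁻ _ p | ∈-map⁻ _ q
  ... | _ , _ , refl | _ , _ , eq = u≢v (proj₂ (∷-injective eq))

∈-Sym⁺ : ∀ {v : Vec (Fin n) n} → T (distinct v) → v ∈ Sym n
∈-Sym⁺ {v = v} d = ∈-filter⁺ (λ v → T? (distinct v)) (∈-allVecs v) d

∈-Sym⁻ : ∀ {v : Vec (Fin n) n} → v ∈ Sym n → T (distinct v)
∈-Sym⁻ {n} v∈ = proj₂ (∈-filter⁻ (λ v → T? (distinct v)) {xs = allVecs n n} v∈)

-- The list whose length is `ballInter` by definition, named so that its members can be spoken of.
ballIntersection : (n r : ℕ) (π τ : Vec (Fin n) n) → List (Vec (Fin n) n)
ballIntersection n r π τ = filter (λ σ → T? (inBall r π σ ∧ inBall r τ σ)) (Sym n)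

ballIntersection-unique : ∀ n r π τ → Unique (ballIntersection n r π τ)
ballIntersection-unique n r π τ = Unique.filter⁺ _ (Unique.filter⁺ _ (allVecs-unique n n))

∈-ballIntersection⁻ : ∀ {n} r π τ {σ} → σ ∈ ballIntersection n r π τ →
                      T (distinct σ) × hamming π σ ≤ r × hamming τ σ ≤ r
∈-ballIntersection⁻ {n} r π τ {σ} σ∈ =
  let σ∈Sym , balls = ∈-filter⁻ (λ σ → T? (inBall r π σ ∧ inBall r τ σ)) {xs = Sym n} σ∈
      ballπ , ballτ = Equivalence.to (T-∧ {inBall r π σ}) balls
  in ∈-Sym⁻ σ∈Sym , ≤ᵇ⇒≤ _ r ballπ , ≤ᵇ⇒≤ _ r ballτ

∈-ballIntersection⁺ : ∀ {n} r π τ {σ} → T (distinct σ) → hamming π σ ≤ r → hamming τ σ ≤ r →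
                      σ ∈ ballIntersection n r π τ
∈-ballIntersection⁺ {n} r π τ dist πσ τσ =
  ∈-filter⁺ (λ σ → T? (inBall r π σ ∧ inBall r τ σ)) (∈-Sym⁺ dist)
    (Equivalence.from T-∧ (≤⇒≤ᵇ πσ , ≤⇒≤ᵇ τσ))

-- Hamming distance

moved : Fin n → Fin n → Bool
moved x y = not ⌊ x ≟ y ⌋

bit : Bool → ℕ
bit b = if b then 1 else 0

hamming-∷ : ∀ (x y : Fin n) (u v : Vec (Fin n) m) →
            hamming (x ∷ u) (y ∷ v) ≡ bit (moved x y) + hamming u v
hamming-∷ x y u v with ⌊ x ≟ y ⌋
... | true  = refl
... | false = refl

moved-triangle : ∀ (x y z : Fin n) → bit (moved x y) ≤ bit (moved x z) + bit (moved y z)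
moved-triangle x y z with x ≟ y | x ≟ z | y ≟ z
... | yes _ | _ | _ = z≤n
... | no _  | no _ | _ = s≤s z≤n
... | no _  | yes _ | no _ = s≤s z≤n
... | no x≢y | yes x≡z | yes y≡z = contradiction (trans x≡z (sym y≡z)) x≢y

hamming-triangle : ∀ (u v w : Vec (Fin n) m) → hamming u v ≤ hamming u w + hamming v w
hamming-triangle []      []      []      = z≤n
hamming-triangle (x ∷ u) (y ∷ v) (z ∷ w)
  rewrite hamming-∷ x y u v | hamming-∷ x z u w | hamming-∷ y z v w = begin
  bit (moved x y) + hamming u v
    ≤⟨ +-mono-≤ (moved-triangle x y z) (hamming-triangle u v w) ⟩
  (bit (moved x z) + bit (moved y z)) + (hamming u w + hamming v w)
    ≡⟨ interchange (bit (moved x z)) _ _ _ ⟩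
  (bit (moved x z) + hamming u w) + (bit (moved y z) + hamming v w) ∎
  where open ≤-Reasoning

Between : (u v w : Vec (Fin n) m) → Set
Between u v w = ∀ i → lookup w i ≡ lookup u i ⊎ lookup w i ≡ lookup v i

-- The triangle inequality holds coordinate by coordinate, so equality of the sums forces equality
-- in each. A value of `w` different from both others would cost 2 where `u` and `v` differ by at
-- most 1.
triangle-equality⇒between : ∀ (u v w : Vec (Fin n) m) →
                            hamming u w + hamming v w ≤ hamming u v → Between u v w
triangle-equality⇒between (x ∷ u) (y ∷ v) (z ∷ w) tight
  rewrite hamming-∷ x y u v | hamming-∷ x z u w | hamming-∷ y z v w
        | interchange (bit (moved x z)) (hamming u w) (bit (moved y z)) (hamming v w) = λ where
    zero    → head (+-cancelʳ-≤ (hamming u v) _ _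
                (≤-trans (+-monoʳ-≤ (bit (moved x z) + bit (moved y z)) (hamming-triangle u v w)) tight))
    (suc i) → triangle-equality⇒between u v w (+-cancelˡ-≤ (bit (moved x z) + bit (moved y z)) _ _
                (≤-trans tight (+-monoˡ-≤ (hamming u v) (moved-triangle x y z)))) i
  where
  head : bit (moved x z) + bit (moved y z) ≤ bit (moved x y) → z ≡ x ⊎ z ≡ y
  head le with x ≟ z | y ≟ z | x ≟ y
  ... | yes x≡z | _       | _ = inj₁ (sym x≡z)
  ... | no  _   | yes y≡z | _ = inj₂ (sym y≡z)
  head (s≤s ()) | no _ | no _ | no _

differences : (u v : Vec (Fin n) m) → List (Fin m)
differences []      []      = []
differences (x ∷ u) (y ∷ v) =
  if moved x y then zero ∷ map suc (differences u v) else map suc (differences u v)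

sum-map-suc : ∀ (f : Fin (suc m) → ℕ) is → sum (map f (map suc is)) ≡ sum (map (f ∘ suc) is)
sum-map-suc f []       = refl
sum-map-suc f (i ∷ is) = cong (f (suc i) +_) (sum-map-suc f is)

-- Where `u` and `v` agree, `w` agrees with them too, so the positions left out contribute nothing
-- to the distance.
sum-differences : ∀ (u v w : Vec (Fin n) m) → Between u v w →
  sum (map (λ i → bit (moved (lookup u i) (lookup w i))) (differences u v)) ≡ hamming u w
sum-differences []      []      []      btw = refl
sum-differences (x ∷ u) (y ∷ v) (z ∷ w) btw rewrite hamming-∷ x z u w with x ≟ y
... | no _ = cong (bit (moved x z) +_)
  (trans (sum-map-suc _ (differences u v)) (sum-differences u v w (btw ∘ suc)))
... | yes refl = trans (trans (sum-map-suc _ (differences u v)) (sum-differences u v w (btw ∘ suc)))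
  (cong (_+ hamming u w) (sym unmoved))
  where
  unmoved : bit (moved x z) ≡ 0
  unmoved with x ≟ z
  ... | yes _ = refl
  ... | no x≢z = contradiction (sym ([ id , id ]′ (btw zero))) x≢z

length-differences : ∀ (u v : Vec (Fin n) m) → length (differences u v) ≡ hamming u v
length-differences []      []      = refl
length-differences (x ∷ u) (y ∷ v) with x ≟ y
... | yes _ = trans (length-map suc (differences u v)) (length-differences u v)
... | no  _ = cong suc (trans (length-map suc (differences u v)) (length-differences u v))

∈-differences⁺ : ∀ (u v : Vec (Fin n) m) i → lookup u i ≢ lookup v i → i ∈ differences u v
∈-differences⁺ (x ∷ u) (y ∷ v) i ui≢vi with x ≟ y
∈-differences⁺ (x ∷ u) (y ∷ v) zero    ui≢vi | yes x≡y = contradiction x≡y ui≢vi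
∈-differences⁺ (x ∷ u) (y ∷ v) (suc i) ui≢vi | yes _   = ∈-map⁺ suc (∈-differences⁺ u v i ui≢vi)
∈-differences⁺ (x ∷ u) (y ∷ v) zero    ui≢vi | no  _   = here refl
∈-differences⁺ (x ∷ u) (y ∷ v) (suc i) ui≢vi | no  _   = there (∈-map⁺ suc (∈-differences⁺ u v i ui≢vi))

∈-differences⁻ : ∀ (u v : Vec (Fin n) m) {i} → i ∈ differences u v → lookup u i ≢ lookup v i
∈-differences⁻ (x ∷ u) (y ∷ v) i∈ with x ≟ y
∈-differences⁻ (x ∷ u) (y ∷ v) (here refl) | no x≢y = x≢y
∈-differences⁻ (x ∷ u) (y ∷ v) (there i∈)  | no _ with ∈-map⁻ suc i∈
... | _ , j∈ , refl = ∈-differences⁻ u v j∈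
∈-differences⁻ (x ∷ u) (y ∷ v) i∈ | yes _ with ∈-map⁻ suc i∈
... | _ , j∈ , refl = ∈-differences⁻ u v j∈

moved-false : ∀ {x y : Fin n} → moved x y ≡ false → y ≡ x
moved-false {x = x} {y} eq with x ≟ y
... | yes x≡y = sym x≡y

moved-true : ∀ {x y : Fin n} → moved x y ≡ true → y ≢ x
moved-true {x = x} {y} eq y≡x with x ≟ y
... | no x≢y = x≢y (sym y≡x)

-- Counting by weighted binary observables

module _ {A : Set} where

  length-filter-split : ∀ (g : A → Bool) X → length X ≡
    length (filter (λ x → g x ≟ᵇ false) X) + length (filter (λ x → g x ≟ᵇ true) X)
  length-filter-split g []      = refl
  length-filter-split g (x ∷ X) with g x
  ... | true  = trans (cong suc (length-filter-split g X)) (sym (+-suc _ _))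
  ... | false = cong suc (length-filter-split g X)

  weigh : List ((A → Bool) × ℕ) → A → ℕ
  weigh obs x = sum (map (λ (g , w) → w * bit (g x)) obs)

  Indistinguishable : List ((A → Bool) × ℕ) → A → A → Set
  Indistinguishable obs x y = All (λ (g , _) → g x ≡ g y) obs

  -- Elements are determined by the set of observables that are true on them, and these sets have
  -- total weight `s`. Splitting `X` by the first observable matches the recursion of `subsetSums`.
  length-≤-subsetSums : ∀ obs {X s} → Unique X → (∀ {x} → x ∈ X → weigh obs x ≡ s) →
    (∀ {x y} → x ∈ X → y ∈ X → Indistinguishable obs x y → x ≡ y) →
    length X ≤ subsetSums (map proj₂ obs) s
  length-≤-subsetSums []        {[]}        _ _ _ = z≤n
  -- The empty selection has weight 0, so the existence of an element forces s = 0.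
  length-≤-subsetSums []        {x ∷ []}    _ weight _ with refl ← weight (here refl) = ≤-refl
  length-≤-subsetSums []        {x ∷ y ∷ X} ((x≢y ∷ _) ∷ _) _ separates =
    contradiction (separates (here refl) (there (here refl)) []) x≢y
  length-≤-subsetSums ((g , w) ∷ obs) {X} {s} X! weight separates = begin
    length X                            ≡⟨ length-filter-split g X ⟩
    length (part false) + length (part true) ≤⟨ +-mono-≤ unselected selected ⟩
    subsetSums (w ∷ map proj₂ obs) s    ∎
    where
    open ≤-Reasoning
    part : Bool → List A
    part b = filter (λ x → g x ≟ᵇ b) X
    part⁻ : ∀ b {x} → x ∈ part b → x ∈ X × g x ≡ b
    part⁻ b = ∈-filter⁻ (λ x → g x ≟ᵇ b)
    part-separates : ∀ b {x y} → x ∈ part b → y ∈ part b → Indistinguishable obs x y → x ≡ y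
    part-separates b x∈ y∈ same =
      let x∈X , gx≡b = part⁻ b x∈ ; y∈X , gy≡b = part⁻ b y∈
      in separates x∈X y∈X (trans gx≡b (sym gy≡b) ∷ same)
    rest-weight : ∀ b {x} → x ∈ part b → w * bit b + weigh obs x ≡ s
    rest-weight b {x} x∈ =
      let x∈X , gx≡b = part⁻ b x∈
      in trans (cong (λ c → w * bit c + weigh obs x) (sym gx≡b)) (weight x∈X)
    unselected : length (part false) ≤ subsetSums (map proj₂ obs) s
    unselected = length-≤-subsetSums obs (Unique.filter⁺ _ X!)
      (λ {x} x∈ → trans (cong (_+ weigh obs x) (sym (*-zeroʳ w))) (rest-weight false x∈))
      (part-separates false)
    selected : length (part true) ≤ delay w (subsetSums (map proj₂ obs)) s
    selected with part true in eq
    ... | []    = z≤n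
    -- A member `x` shows that s is `w + weigh obs x`, which makes the delay computable.
    ... | x ∷ Y = ≤-trans (length-≤-subsetSums obs {x ∷ Y} {weigh obs x}
          (subst Unique eq (Unique.filter⁺ _ X!))
          (λ y∈ → +-cancelˡ-≡ w _ _ (trans (w+ y∈) (sym (w+ (here refl)))))
          (λ x∈ y∈ → part-separates true (subst (_ ∈_) (sym eq) x∈) (subst (_ ∈_) (sym eq) y∈)))
        (≤-reflexive (trans (sym (delay-+ w _ (weigh obs x))) (cong (delay w _) (w+ (here refl)))))
      where
      w+ : ∀ {y} → y ∈ x ∷ Y → w + weigh obs y ≡ s
      w+ {y} y∈ = trans (cong (_+ weigh obs y) (sym (*-identityʳ w)))
                        (rest-weight true (subst (y ∈_) (sym eq) y∈))

-- Blocks of linked positions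

module _ {I : Set} {_~_ : I → I → Set} (~-refl : ∀ {i} → i ~ i)
         (~-sym : ∀ {i j} → i ~ j → j ~ i) (~-trans : ∀ {i j k} → i ~ j → j ~ k → i ~ k) where

  -- Comparison with one representative `c` replaces pairwise links and later supplies the
  -- observable of the block; the size bound becomes the bound on its weight.
  IsBlock : List I → Set
  IsBlock is = ∃ λ c → 2 ≤ length is × All (c ~_) is

  insert-block : ∀ {i j B} → All IsBlock B → i ~ j → j ∈ concat B →
                 ∃ λ B′ → All IsBlock B′ × concat B′ ↭ i ∷ concat B
  insert-block {i} {j} {b ∷ B} ((c , 2≤ , c~) ∷ blocks) i~j j∈ with ∈-++⁻ b j∈
  ... | inj₁ j∈b = (i ∷ b) ∷ B
                 , (c , m≤n⇒m≤1+n 2≤ , ~-trans (All.lookup c~ j∈b) (~-sym i~j) ∷ c~) ∷ blocks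
                 , ↭-refl
  ... | inj₂ j∈B = let B′ , blocks′ , p = insert-block blocks i~j j∈B in
    b ∷ B′ , (c , 2≤ , c~) ∷ blocks′ , ↭-trans (++⁺ˡ b p) (shift i b (concat B))

  -- Greedily: a position joins the block of its partner, or forms a new block with it.
  partition-into-blocks : ∀ D → (∀ {i} → i ∈ D → ∃ λ j → j ∈ D × i ≢ j × i ~ j) →
                          ∃ λ B → All IsBlock B × concat B ↭ D
  partition-into-blocks D partner = go (length D) [] [] D ≤-refl ↭-refl
    where
    -- The number `k` bounds the count of unplaced positions `U` and ensures termination: each round
    -- places one or two of them.
    go : ∀ k B → All IsBlock B → ∀ U → length U ≤ k → concat B ++ U ↭ D →
         ∃ λ B → All IsBlock B × concat B ↭ D
    go k B blocks [] _ p =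
      B , blocks , ↭-trans (↭-reflexive (sym (List.++-identityʳ (concat B)))) p
    go (suc k) B blocks (i ∷ U) (s≤s ≤k) p
      with partner (∈-resp-↭ p (∈-insert (concat B)))
    ... | j , j∈D , i≢j , i~j with ∈-++⁻ (concat B) (∈-resp-↭ (↭-sym p) j∈D)
    ...   | inj₂ (here j≡i) = contradiction (sym j≡i) i≢j
    ...   | inj₁ j∈B = let B′ , blocks′ , q = insert-block blocks i~j j∈B in
      go k B′ blocks′ U ≤k (↭-trans (++⁺ʳ U q) (↭-trans (↭-sym (shift i (concat B) U)) p))
    ...   | inj₂ (there j∈U) with ∈-∃++ j∈U
    ...     | U₁ , U₂ , refl =
      go k ((i ∷ j ∷ []) ∷ B) ((i , s≤s (s≤s z≤n) , ~-refl ∷ i~j ∷ []) ∷ blocks) (U₁ ++ U₂)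
         (≤-trans (≤-trans (n≤1+n _) (≤-reflexive (sym (↭-length (shift j U₁ U₂))))) ≤k)
         (↭-trans (prep i (↭-trans (↭-sym (shift j (concat B) (U₁ ++ U₂)))
                                    (++⁺ˡ (concat B) (↭-sym (shift j U₁ U₂)))))
           (↭-trans (↭-sym (shift i (concat B) (U₁ ++ j ∷ U₂))) p))

-- The upper bound

module _ {n r : ℕ} (π τ : Vec (Fin n) n)
         (π-distinct : T (distinct π)) (τ-distinct : T (distinct τ))
         (far : r * 2 ≤ hamming π τ) where

  private
    X : List (Vec (Fin n) n)
    X = ballIntersection n r π τ

    π-injective : Injective _≡_ _≡_ (lookup π)
    π-injective = distinct⁻ π π-distinct
    τ-injective : Injective _≡_ _≡_ (lookup τ)
    τ-injective = distinct⁻ τ τ-distinct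

    -- The value `true` means that σ departs from π at `i`, which for a σ in `X` means that it
    -- follows τ there.
    observe : Fin n → Vec (Fin n) n → Bool
    observe i σ = moved (lookup π i) (lookup σ i)

    -- Read off from the members of `X` rather than from the cycles of π⁻¹τ, which makes it an
    -- equivalence relation at once.
    Linked : Fin n → Fin n → Set
    Linked i j = ∀ {σ} → σ ∈ X → observe i σ ≡ observe j σ

    -- The two distances add up to at most 2r, which is at most d(π,τ), so the triangle inequality
    -- is tight.
    between : ∀ {σ} → σ ∈ X → Between π τ σ
    between {σ} σ∈ = let _ , πσ≤r , τσ≤r = ∈-ballIntersection⁻ r π τ σ∈ in
      triangle-equality⇒between π τ σ
        (≤-trans (+-mono-≤ πσ≤r τσ≤r) (≤-trans (≤-reflexive (sym (n*2≡n+n r))) far))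

    distance-πσ : ∀ {σ} → σ ∈ X → hamming π σ ≡ r
    distance-πσ {σ} σ∈ = let _ , πσ≤r , τσ≤r = ∈-ballIntersection⁻ r π τ σ∈ in
      ≤-antisym πσ≤r (+-cancelʳ-≤ r r (hamming π σ) (begin
        r + r                     ≡⟨ n*2≡n+n r ⟨
        r * 2                     ≤⟨ far ⟩
        hamming π τ               ≤⟨ hamming-triangle π τ σ ⟩
        hamming π σ + hamming τ σ ≤⟨ +-monoʳ-≤ (hamming π σ) τσ≤r ⟩
        hamming π σ + r           ∎))
      where open ≤-Reasoning

    distance-πτ : ∀ {σ} → σ ∈ X → hamming π τ ≡ r * 2
    distance-πτ {σ} σ∈ = let _ , πσ≤r , τσ≤r = ∈-ballIntersection⁻ r π τ σ∈ in
      ≤-antisym (≤-trans (hamming-triangle π τ σ)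
                  (≤-trans (+-mono-≤ πσ≤r τσ≤r) (≤-reflexive (sym (n*2≡n+n r))))) far

    -- The partner of i is the position j with π j = τ i. If σ i = τ i, then σ j ≠ π j by
    -- injectivity; if σ i = π i and σ j = τ j, then no position is left to take the value π j.
    partner : ∀ {i} → i ∈ differences π τ →
              ∃ λ j → j ∈ differences π τ × i ≢ j × Linked i j
    partner {i} i∈ with injective⇒surjective π-injective (lookup τ i)
    ... | j , πj≡τi = j , ∈-differences⁺ π τ j πj≢τj , i≢j , linked
      where
      πi≢τi : lookup π i ≢ lookup τ i
      πi≢τi = ∈-differences⁻ π τ i∈
      i≢j : i ≢ j
      i≢j refl = πi≢τi πj≡τi
      πj≢τj : lookup π j ≢ lookup τ j
      πj≢τj πj≡τj = i≢j (τ-injective (trans (sym πj≡τi) πj≡τj))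
      linked : Linked i j
      linked {σ} σ∈ with observe i σ in eqᵢ | observe j σ in eqⱼ
      ... | false | false = refl
      ... | true  | true  = refl
      ... | true  | false = contradiction
        (distinct⁻ σ (proj₁ (∈-ballIntersection⁻ r π τ σ∈)) σi≡σj) i≢j
        where
        σi≡σj : lookup σ i ≡ lookup σ j
        σi≡σj with between σ∈ i
        ... | inj₁ σi≡πi = contradiction σi≡πi (moved-true eqᵢ)
        ... | inj₂ σi≡τi = trans σi≡τi (trans (sym πj≡τi) (sym (moved-false eqⱼ)))
      ... | false | true
        with injective⇒surjective (distinct⁻ σ (proj₁ (∈-ballIntersection⁻ r π τ σ∈))) (lookup π j)
      ...   | k , σk≡πj with between σ∈ k
      ...     | inj₁ σk≡πk with refl ← π-injective (trans (sym σk≡πk) σk≡πj) =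
        contradiction σk≡πj (moved-true eqⱼ)
      ...     | inj₂ σk≡τk with refl ← τ-injective (trans (sym σk≡τk) (trans σk≡πj πj≡τi)) =
        contradiction (trans (sym (moved-false eqᵢ)) σk≡τk) πi≢τi

    Block : List (Fin n) → Set
    Block = IsBlock {_~_ = Linked} (λ _ → refl) (λ p σ∈ → sym (p σ∈)) (λ p q σ∈ → trans (p σ∈) (q σ∈))

    -- One observable for each block, read at the representative and weighted by the block size; the
    -- total weight of σ is then d(π,σ).
    observables : ∀ {B} → All Block B → List ((Vec (Fin n) n → Bool) × ℕ)
    observables []                               = []
    observables {b ∷ _} ((c , _) ∷ blocks) = (observe c , length b) ∷ observables blocks

    weights : ∀ {B} (blocks : All Block B) → map proj₂ (observables blocks) ≡ map length B
    weights []             = refl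
    weights {b ∷ _} (_ ∷ blocks) = cong (length b ∷_) (weights blocks)

    weigh-block : ∀ {c b σ} → σ ∈ X → All (Linked c) b →
                  length b * bit (observe c σ) ≡ sum (map (λ i → bit (observe i σ)) b)
    weigh-block σ∈ []         = refl
    weigh-block σ∈ (c~i ∷ c~) = cong₂ _+_ (cong bit (c~i σ∈)) (weigh-block σ∈ c~)

    weigh-blocks : ∀ {B σ} (blocks : All Block B) → σ ∈ X →
      weigh (observables blocks) σ ≡ sum (map (λ i → bit (observe i σ)) (concat B))
    weigh-blocks []       σ∈ = refl
    weigh-blocks {b ∷ B} {σ} ((c , _ , c~) ∷ blocks) σ∈ = begin
      length b * bit (observe c σ) + weigh (observables blocks) σ
        ≡⟨ cong₂ _+_ (weigh-block σ∈ c~) (weigh-blocks blocks σ∈) ⟩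
      sum (map g b) + sum (map g (concat B))     ≡⟨ sum-++ (map g b) _ ⟨
      sum (map g b ++ map g (concat B))          ≡⟨ cong sum (map-++ g b (concat B)) ⟨
      sum (map g (b ++ concat B))                ∎
      where
      open ≡-Reasoning
      g : Fin n → ℕ
      g i = bit (observe i σ)

    agree : ∀ {B σ σ′} (blocks : All Block B) → σ ∈ X → σ′ ∈ X →
            Indistinguishable (observables blocks) σ σ′ →
            ∀ {i} → i ∈ concat B → observe i σ ≡ observe i σ′
    agree {b ∷ B} ((c , _ , c~) ∷ blocks) σ∈ σ′∈ (same ∷ sames) i∈ with ∈-++⁻ b i∈
    ... | inj₁ i∈b = trans (sym (All.lookup c~ i∈b σ∈)) (trans same (All.lookup c~ i∈b σ′∈))
    ... | inj₂ i∈B = agree blocks σ∈ σ′∈ sames i∈B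

    -- At each position σ takes the value of π or of τ; the observations settle which one wherever
    -- the two values differ.
    determined : ∀ {σ σ′} → σ ∈ X → σ′ ∈ X →
                 (∀ {i} → i ∈ differences π τ → observe i σ ≡ observe i σ′) → σ ≡ σ′
    determined {σ} {σ′} σ∈ σ′∈ same = lookup-ext pointwise
      where
      pointwise : ∀ i → lookup σ i ≡ lookup σ′ i
      pointwise i with between σ∈ i | between σ′∈ i
      ... | inj₁ p | inj₁ q = trans p (sym q)
      ... | inj₂ p | inj₂ q = trans p (sym q)
      ... | inj₁ p | inj₂ q with lookup π i ≟ lookup τ i
      ...   | yes π≡τ = trans p (trans π≡τ (sym q))
      ...   | no  π≢τ with observe i σ′ in eq
      ...     | false = trans p (sym (moved-false eq))
      ...     | true  = contradiction p (moved-true (trans (same (∈-differences⁺ π τ i π≢τ)) eq))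
      pointwise i | inj₂ p | inj₁ q with lookup π i ≟ lookup τ i
      ...   | yes π≡τ = trans p (trans (sym π≡τ) (sym q))
      ...   | no  π≢τ with observe i σ in eq
      ...     | false = trans (moved-false eq) (sym q)
      ...     | true  = contradiction q (moved-true (trans (sym (same (∈-differences⁺ π τ i π≢τ))) eq))

  -- The block sizes form a list of weights of at least 2 with sum 2r, and the members of `X`
  -- correspond to selections of blocks of total size r. What remains is a bound on subset sums,
  -- left as a hypothesis so that both parities of r can use it.
  ballInter-≤ : ∀ {b} → (∀ {L} → All (2 ≤_) L → sum L ≡ r * 2 → subsetSums L r ≤ b) →
                ballInter n r π τ ≤ b
  ballInter-≤ {b} bound
    with partition-into-blocks {_~_ = Linked} (λ _ → refl) (λ p σ∈ → sym (p σ∈))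
           (λ p q σ∈ → trans (p σ∈) (q σ∈)) (differences π τ) partner
  ... | B , blocks , p = nonempty X refl
    where
    sum-lengths : ∀ (B : List (List (Fin n))) → sum (map length B) ≡ length (concat B)
    sum-lengths []      = refl
    sum-lengths (b ∷ B) = trans (cong (length b +_) (sum-lengths B)) (sym (length-++ b))

    total : ∀ {σ} → σ ∈ X → sum (map length B) ≡ r * 2
    total σ∈ = trans (sum-lengths B) (trans (↭-length p) (trans (length-differences π τ) (distance-πτ σ∈)))

    weight : ∀ {σ} → σ ∈ X → weigh (observables blocks) σ ≡ r
    weight {σ} σ∈ = trans (weigh-blocks blocks σ∈) (trans (sum-↭ (↭-map⁺ _ p))
      (trans (sum-differences π τ σ (between σ∈)) (distance-πσ σ∈)))

    counted : length X ≤ subsetSums (map length B) r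
    counted = subst (λ L → length X ≤ subsetSums L r) (weights blocks)
      (length-≤-subsetSums (observables blocks) (ballIntersection-unique n r π τ) weight
        (λ σ∈ σ′∈ same → determined σ∈ σ′∈ (λ i∈ → agree blocks σ∈ σ′∈ same (∈-resp-↭ (↭-sym p) i∈))))

    -- That d(π,τ) is exactly 2r, and hence the sum of the block sizes, is known only once some σ is
    -- at hand; an empty intersection is bounded trivially.
    nonempty : ∀ Y → X ≡ Y → length Y ≤ b
    nonempty []      _  = z≤n
    nonempty (σ ∷ Y) eq = ≤-trans (subst (λ Z → length Z ≤ subsetSums (map length B) r) eq counted)
      (bound (All.map⁺ (All.map (λ (_ , 2≤ , _) → 2≤) blocks)) (total (subst (σ ∈_) (sym eq) (here refl))))

-- The maximum that defines `N`

max-≤ : ∀ {b} {xs : List ℕ} → All (_≤ b) xs → foldr _⊔_ 0 xs ≤ b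
max-≤ []       = z≤n
max-≤ (x ∷ xs) = ⊔-lub x (max-≤ xs)

≤-max : ∀ {x} {xs : List ℕ} → x ∈ xs → x ≤ foldr _⊔_ 0 xs
≤-max {xs = y ∷ xs} (here refl) = m≤m⊔n y _
≤-max {xs = y ∷ xs} (there x∈)  = ≤-trans (≤-max x∈) (m≤n⊔m y _)

N-≤ : ∀ {n d r b} →
      (∀ π τ → T (distinct π) → T (distinct τ) → d ≤ hamming π τ → ballInter n r π τ ≤ b) →
      N n d r ≤ b
N-≤ {n} {d} {r} {b} bound = max-≤ (All.concat⁺ (All.map⁺ (All.tabulate λ {π} π∈ →
  All.map⁺ (All.tabulate λ {τ} τ∈ → entry π∈ τ∈))))
  where
  entry : ∀ {π τ} → π ∈ Sym n → τ ∈ Sym n →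
          (if d ≤ᵇ hamming π τ then ballInter n r π τ else 0) ≤ b
  entry {π} {τ} π∈ τ∈ with d ≤ᵇ hamming π τ in eq
  ... | false = z≤n
  ... | true  = bound π τ (∈-Sym⁻ π∈) (∈-Sym⁻ τ∈) (≤ᵇ⇒≤ d _ (subst T (sym eq) _))

≤-N : ∀ {n d r} (π τ : Vec (Fin n) n) → T (distinct π) → T (distinct τ) → d ≤ hamming π τ →
      ballInter n r π τ ≤ N n d r
≤-N {n} {d} {r} π τ π-distinct τ-distinct far = ≤-max
  (∈-concatMap⁺ (λ π → map (λ τ → entry π τ) (Sym n))
    (Any.map (λ { refl → subst (_∈ map (entry π) (Sym n)) entry≡ (∈-map⁺ (entry π) (∈-Sym⁺ {v = τ} τ-distinct)) })
             (∈-Sym⁺ {v = π} π-distinct)))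
  where
  entry : Vec (Fin n) n → Vec (Fin n) n → ℕ
  entry π τ = if d ≤ᵇ hamming π τ then ballInter n r π τ else 0
  entry≡ : entry π τ ≡ ballInter n r π τ
  entry≡ with d ≤ᵇ hamming π τ | ≤⇒≤ᵇ far
  ... | true | _ = refl

-- Direct sums

_⊕_ : Vec (Fin a) a → Vec (Fin m) m → Vec (Fin (a + m)) (a + m)
_⊕_ {a} {m} p v = Vec.map (_↑ˡ m) p Vec.++ Vec.map (a ↑ʳ_) v

infixr 5 _⊕_

hamming-refl : ∀ (u : Vec (Fin n) m) → hamming u u ≡ 0
hamming-refl []      = refl
hamming-refl (x ∷ u) with x ≟ x
... | yes _   = hamming-refl u
... | no  x≢x = contradiction refl x≢x

hamming-map : ∀ {f : Fin n → Fin a} → Injective _≡_ _≡_ f → ∀ (u v : Vec (Fin n) m) →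
              hamming (Vec.map f u) (Vec.map f v) ≡ hamming u v
hamming-map inj []      []      = refl
hamming-map {f = f} inj (x ∷ u) (y ∷ v) with x ≟ y | f x ≟ f y
... | yes _   | yes _     = hamming-map inj u v
... | no  _   | no _      = cong suc (hamming-map inj u v)
... | yes x≡y | no fx≢fy  = contradiction (cong f x≡y) fx≢fy
... | no x≢y  | yes fx≡fy = contradiction (inj fx≡fy) x≢y

hamming-++ : ∀ (p q : Vec (Fin n) a) (u v : Vec (Fin n) m) →
             hamming (p Vec.++ u) (q Vec.++ v) ≡ hamming p q + hamming u v
hamming-++ []      []      u v = refl
hamming-++ (x ∷ p) (y ∷ q) u v =
  trans (cong (_ +_) (hamming-++ p q u v)) (sym (+-assoc _ (hamming p q) (hamming u v)))

hamming-⊕ : ∀ (p q : Vec (Fin a) a) (u v : Vec (Fin m) m) →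
            hamming (p ⊕ u) (q ⊕ v) ≡ hamming p q + hamming u v
hamming-⊕ {a} {m} p q u v = trans (hamming-++ (Vec.map (_↑ˡ m) p) (Vec.map (_↑ˡ m) q) _ _)
  (cong₂ _+_ (hamming-map (↑ˡ-injective m _ _) p q) (hamming-map (↑ʳ-injective a _ _) u v))

map-injective : ∀ {A B : Set} {f : A → B} → Injective _≡_ _≡_ f →
                Injective _≡_ _≡_ (Vec.map {n = m} f)
map-injective inj {[]}    {[]}    eq = refl
map-injective inj {_ ∷ _} {_ ∷ _} eq =
  let x≡y , u≡v = ∷-injective eq in cong₂ _∷_ (inj x≡y) (map-injective inj u≡v)

⊕-injective : ∀ (p q : Vec (Fin a) a) (u v : Vec (Fin m) m) → p ⊕ u ≡ q ⊕ v → p ≡ q × u ≡ v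
⊕-injective {a} {m} p q u v eq =
  let l , r = ++-injective (Vec.map (_↑ˡ m) p) (Vec.map (_↑ˡ m) q) eq
  in map-injective (↑ˡ-injective m _ _) l , map-injective (↑ʳ-injective a _ _) r

distinct-⊕ : ∀ (p : Vec (Fin a) a) (v : Vec (Fin m) m) →
             T (distinct p) → T (distinct v) → T (distinct (p ⊕ v))
distinct-⊕ {a} {m} p v p-distinct v-distinct = distinct⁺ (p ⊕ v) λ {i} {j} → injective i j
  where
  left : ∀ i → lookup (p ⊕ v) (i ↑ˡ m) ≡ lookup p i ↑ˡ m
  left i = trans (lookup-++ˡ (Vec.map (_↑ˡ m) p) _ i) (lookup-map i (_↑ˡ m) p)
  right : ∀ i → lookup (p ⊕ v) (a ↑ʳ i) ≡ a ↑ʳ lookup v i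
  right i = trans (lookup-++ʳ (Vec.map (_↑ˡ m) p) _ i) (lookup-map i (a ↑ʳ_) v)
  left≢right : ∀ {i : Fin a} {j : Fin m} → i ↑ˡ m ≢ a ↑ʳ j
  left≢right {i} {j} eq with () ←
    trans (sym (splitAt-↑ˡ a i m)) (trans (cong (splitAt a) eq) (splitAt-↑ʳ a m j))
  injective : ∀ i j → lookup (p ⊕ v) i ≡ lookup (p ⊕ v) j → i ≡ j
  injective i j eq with splitAt a i in eqᵢ | splitAt a j in eqⱼ
  ... | inj₁ i′ | inj₁ j′
    with refl ← splitAt⁻¹-↑ˡ eqᵢ | refl ← splitAt⁻¹-↑ˡ eqⱼ =
    cong (_↑ˡ m) (distinct⁻ p p-distinct
      (↑ˡ-injective m _ _ (trans (sym (left i′)) (trans eq (left j′)))))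
  ... | inj₂ i′ | inj₂ j′
    with refl ← splitAt⁻¹-↑ʳ {a} eqᵢ | refl ← splitAt⁻¹-↑ʳ {a} eqⱼ =
    cong (a ↑ʳ_) (distinct⁻ v v-distinct
      (↑ʳ-injective a _ _ (trans (sym (right i′)) (trans eq (right j′)))))
  ... | inj₁ i′ | inj₂ j′
    with refl ← splitAt⁻¹-↑ˡ eqᵢ | refl ← splitAt⁻¹-↑ʳ {a} eqⱼ =
    contradiction (trans (sym (left i′)) (trans eq (right j′))) left≢right
  ... | inj₂ i′ | inj₁ j′
    with refl ← splitAt⁻¹-↑ʳ {a} eqᵢ | refl ← splitAt⁻¹-↑ˡ eqⱼ =
    contradiction (sym (trans (sym (right i′)) (trans eq (left j′)))) left≢right

distinct-allFin : ∀ m → T (distinct (Vec.allFin m))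
distinct-allFin m = distinct⁺ (Vec.allFin m) λ {i} {j} eq →
  trans (sym (lookup-allFin i)) (trans eq (lookup-allFin j))

-- The lower bound

id₂ swap₂ : Vec (Fin 2) 2
id₂   = zero ∷ suc zero ∷ []
swap₂ = suc zero ∷ zero ∷ []

id₃ rotate₃ : Vec (Fin 3) 3
id₃     = zero ∷ suc zero ∷ suc (suc zero) ∷ []
rotate₃ = suc zero ∷ suc (suc zero) ∷ zero ∷ []

-- `unswapped` is the identity, built as a direct sum in the pattern of `swapped` so that distances
-- can be added summand by summand; the last `m` positions are fixed by both.
unswapped swapped : ∀ k m → Vec (Fin (k * 2 + m)) (k * 2 + m)
unswapped zero    m = Vec.allFin m
unswapped (suc k) m = id₂ ⊕ unswapped k m
swapped   zero    m = Vec.allFin m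
swapped   (suc k) m = swap₂ ⊕ swapped k m

-- The products of exactly `j` of the `k` transpositions; the recursion is Pascal's rule.
swapsOf : ∀ k m (j : ℕ) → List (Vec (Fin (k * 2 + m)) (k * 2 + m))
swapsOf zero    m zero    = Vec.allFin m ∷ []
swapsOf zero    m (suc j) = []
swapsOf (suc k) m zero    = map (id₂ ⊕_) (swapsOf k m zero)
swapsOf (suc k) m (suc j) = map (id₂ ⊕_) (swapsOf k m (suc j)) ++ map (swap₂ ⊕_) (swapsOf k m j)

distinct-unswapped : ∀ k m → T (distinct (unswapped k m))
distinct-unswapped zero    m = distinct-allFin m
distinct-unswapped (suc k) m = distinct-⊕ id₂ (unswapped k m) _ (distinct-unswapped k m)

distinct-swapped : ∀ k m → T (distinct (swapped k m))
distinct-swapped zero    m = distinct-allFin m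
distinct-swapped (suc k) m = distinct-⊕ swap₂ (swapped k m) _ (distinct-swapped k m)

hamming-unswapped-swapped : ∀ k m → hamming (unswapped k m) (swapped k m) ≡ k * 2
hamming-unswapped-swapped zero    m = hamming-refl (Vec.allFin m)
hamming-unswapped-swapped (suc k) m =
  trans (hamming-⊕ id₂ swap₂ (unswapped k m) (swapped k m))
        (cong (2 +_) (hamming-unswapped-swapped k m))

-- The sum of the two distances is recorded in place of the second one: with `j` of `k` swaps
-- performed it is 2k, and no difference k - j has to be handled.
record Splits {n} (π τ : Vec (Fin n) n) (x y : ℕ) (σ : Vec (Fin n) n) : Set where
  constructor splits
  field
    σ-distinct  : T (distinct σ)
    hamming-πσ  : hamming π σ ≡ x
    hamming-sum : hamming π σ + hamming τ σ ≡ y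

splits-⊕ : ∀ {a m x y} (p q o : Vec (Fin a) a) {π τ : Vec (Fin m) m} → T (distinct o) → ∀ {σ} →
           Splits π τ x y σ →
           Splits (p ⊕ π) (q ⊕ τ) (hamming p o + x) ((hamming p o + hamming q o) + y) (o ⊕ σ)
splits-⊕ p q o {π} {τ} o-distinct {σ} (splits σ-distinct refl refl) = splits
  (distinct-⊕ o σ o-distinct σ-distinct)
  (hamming-⊕ p o π σ)
  (trans (cong₂ _+_ (hamming-⊕ p o π σ) (hamming-⊕ q o τ σ))
         (interchange (hamming p o) (hamming π σ) (hamming q o) (hamming τ σ)))

swapsOf-split : ∀ k m j → All (Splits (unswapped k m) (swapped k m) (j * 2) (k * 2)) (swapsOf k m j)
swapsOf-split zero    m zero    = splits (distinct-allFin m) (hamming-refl (Vec.allFin m))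
  (cong₂ _+_ (hamming-refl (Vec.allFin m)) (hamming-refl (Vec.allFin m))) ∷ []
swapsOf-split zero    m (suc j) = []
swapsOf-split (suc k) m zero    =
  All.map⁺ (All.map (splits-⊕ id₂ swap₂ id₂ _) (swapsOf-split k m zero))
swapsOf-split (suc k) m (suc j) = All.++⁺
  (All.map⁺ (All.map (splits-⊕ id₂ swap₂ id₂ _) (swapsOf-split k m (suc j))))
  (All.map⁺ (All.map (splits-⊕ id₂ swap₂ swap₂ _) (swapsOf-split k m j)))

map-⊕-unique : ∀ (p : Vec (Fin a) a) {xs : List (Vec (Fin m) m)} → Unique xs → Unique (map (p ⊕_) xs)
map-⊕-unique p = Unique.map⁺ (λ {u} {v} eq → proj₂ (⊕-injective p p u v eq))

++-⊕-unique : ∀ {p q : Vec (Fin a) a} {xs ys : List (Vec (Fin m) m)} → p ≢ q →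
              Unique xs → Unique ys → Unique (map (p ⊕_) xs ++ map (q ⊕_) ys)
++-⊕-unique {p = p} {q} p≢q xs! ys! = Unique.++⁺ (map-⊕-unique p xs!) (map-⊕-unique q ys!) disjoint
  where
  disjoint : ∀ {w} → ¬ (w ∈ map (p ⊕_) _ × w ∈ map (q ⊕_) _)
  disjoint (w∈ , w∈′) with ∈-map⁻ (p ⊕_) w∈ | ∈-map⁻ (q ⊕_) w∈′
  ... | u , _ , refl | v , _ , eq = p≢q (proj₁ (⊕-injective p q u v eq))

swapsOf-unique : ∀ k m j → Unique (swapsOf k m j)
swapsOf-unique zero    m zero    = [] ∷ []
swapsOf-unique zero    m (suc j) = []
swapsOf-unique (suc k) m zero    = map-⊕-unique id₂ (swapsOf-unique k m zero)
swapsOf-unique (suc k) m (suc j) =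
  ++-⊕-unique (λ ()) (swapsOf-unique k m (suc j)) (swapsOf-unique k m j)

length-swapsOf : ∀ k m (j : ℕ) → length (swapsOf k m j) ≡ k C j
length-swapsOf zero    m zero    = refl
length-swapsOf zero    m (suc j) = refl
length-swapsOf (suc k) m zero    = begin
  length (map (id₂ ⊕_) (swapsOf k m zero)) ≡⟨ length-map (id₂ ⊕_) (swapsOf k m zero) ⟩
  length (swapsOf k m zero)                ≡⟨ length-swapsOf k m zero ⟩
  k C 0                                    ≡⟨ nC0≡1 k ⟩
  1                                        ≡⟨ nC0≡1 (suc k) ⟨
  suc k C 0                                ∎
  where open ≡-Reasoning
length-swapsOf (suc k) m (suc j) = begin
  length (map (id₂ ⊕_) (swapsOf k m (suc j)) ++ map (swap₂ ⊕_) (swapsOf k m j))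
    ≡⟨ length-++ (map (id₂ ⊕_) (swapsOf k m (suc j))) ⟩
  length (map (id₂ ⊕_) (swapsOf k m (suc j))) + length (map (swap₂ ⊕_) (swapsOf k m j))
    ≡⟨ cong₂ _+_ (trans (length-map (id₂ ⊕_) (swapsOf k m (suc j))) (length-swapsOf k m (suc j)))
                 (trans (length-map (swap₂ ⊕_) (swapsOf k m j)) (length-swapsOf k m j)) ⟩
  k C suc j + k C j   ≡⟨ +-comm (k C suc j) (k C j) ⟩
  k C j + k C suc j   ≡⟨ nCk+nC[k+1]≡[n+1]C[k+1] k j ⟩
  suc k C suc j       ∎
  where open ≡-Reasoning

unique-⊆⇒length-≤ : ∀ {A : Set} {xs ys : List A} → Unique xs → (∀ {x} → x ∈ xs → x ∈ ys) →
                    length xs ≤ length ys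
unique-⊆⇒length-≤ []            _     = z≤n
unique-⊆⇒length-≤ {xs = x ∷ xs} (x∉ ∷ xs!) xs⊆ys with ∈-∃++ (xs⊆ys (here refl))
... | ys₁ , ys₂ , refl = ≤-trans (s≤s (unique-⊆⇒length-≤ xs! xs⊆))
        (≤-reflexive (sym (↭-length (shift x ys₁ ys₂))))
  where
  xs⊆ : ∀ {y} → y ∈ xs → y ∈ ys₁ ++ ys₂
  xs⊆ y∈ with ∈-++⁻ ys₁ (xs⊆ys (there y∈))
  ... | inj₁ y∈₁         = ∈-++⁺ˡ y∈₁
  ... | inj₂ (here refl) = contradiction refl (All.lookup x∉ y∈)
  ... | inj₂ (there y∈₂) = ∈-++⁺ʳ ys₁ y∈₂

-- A first distance r and a total r + r give the second distance r, so `Y` lies in the intersection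
-- of the balls.
N-≥ : ∀ {n d r} (π τ : Vec (Fin n) n) → T (distinct π) → T (distinct τ) → hamming π τ ≡ d →
      ∀ {Y} → Unique Y → All (Splits π τ r (r + r)) Y → length Y ≤ N n d r
N-≥ {n} {d} {r} π τ π-distinct τ-distinct eq {Y} Y! halves =
  ≤-trans (unique-⊆⇒length-≤ Y! (member ∘ All.lookup halves))
          (≤-N π τ π-distinct τ-distinct (≤-reflexive (sym eq)))
  where
  member : ∀ {σ} → Splits π τ r (r + r) σ → σ ∈ ballIntersection n r π τ
  member {σ} (splits σ-distinct πσ total) = ∈-ballIntersection⁺ r π τ σ-distinct (≤-reflexive πσ)
    (≤-reflexive (+-cancelˡ-≡ r _ _ (trans (cong (_+ hamming τ σ) (sym πσ)) total)))

-- The two values of `N`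

-- For the lower bound τ consists of 2t disjoint transpositions, and the permutations that perform t
-- of them are at distance 2t from both centres. The remaining n - 4t positions are fixed.
N-even : ∀ t n → (t * 2) * 2 ≤ n → N n ((t * 2) * 2) (t * 2) ≡ (t * 2) C t
N-even t n 4t≤n = ≤-antisym
  (N-≤ {n} λ π τ π-distinct τ-distinct far →
    ballInter-≤ π τ π-distinct τ-distinct far (λ 2≤L eq → subsetSums-≤-even t 2≤L eq (t * 2)))
  (subst (λ n → (t * 2) C t ≤ N n ((t * 2) * 2) (t * 2)) (m+[n∸m]≡n 4t≤n) lower)
  where
  fixed : ℕ
  fixed = n ∸ (t * 2) * 2
  lower : (t * 2) C t ≤ N ((t * 2) * 2 + fixed) ((t * 2) * 2) (t * 2)
  lower = ≤-trans (≤-reflexive (sym (length-swapsOf (t * 2) fixed t)))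
    (N-≥ (unswapped (t * 2) fixed) (swapped (t * 2) fixed)
      (distinct-unswapped (t * 2) fixed) (distinct-swapped (t * 2) fixed)
      (hamming-unswapped-swapped (t * 2) fixed) (swapsOf-unique (t * 2) fixed t)
      (subst (λ y → All (Splits (unswapped (t * 2) fixed) (swapped (t * 2) fixed) (t * 2) y)
                        (swapsOf (t * 2) fixed t))
        (n*2≡n+n (t * 2)) (swapsOf-split (t * 2) fixed t)))

-- Here u = t - 2. For the lower bound τ consists of two 3-cycles and 2t - 2 transpositions, which
-- move 6 + 2(2t - 2) = 2r positions.
N-odd : ∀ u n → (1 + suc (suc u) * 2) * 2 ≤ n →
        N n ((1 + suc (suc u) * 2) * 2) (1 + suc (suc u) * 2) ≡ 2 * ((suc u * 2) C suc u)
N-odd u n 2r≤n = ≤-antisym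
  (N-≤ {n} λ π τ π-distinct τ-distinct far →
    ballInter-≤ π τ π-distinct τ-distinct far (subsetSums-≤-odd u))
  (subst (λ n → 2 * (k C suc u) ≤ N n (r * 2) r) (m+[n∸m]≡n 2r≤n) lower)
  where
  k = suc u * 2
  r = 1 + suc (suc u) * 2
  fixed : ℕ
  fixed = n ∸ r * 2
  π τ : Vec (Fin (6 + (k * 2 + fixed))) (6 + (k * 2 + fixed))
  π = id₃ ⊕ id₃ ⊕ unswapped k fixed
  τ = rotate₃ ⊕ rotate₃ ⊕ swapped k fixed
  -- Exactly one of the two 3-cycles and t - 1 of the transpositions are performed: 3 + 2(t - 1) = r
  -- positions follow τ.
  first second : List (Vec (Fin (6 + (k * 2 + fixed))) (6 + (k * 2 + fixed)))
  first  = map (rotate₃ ⊕_) (map (id₃ ⊕_) (swapsOf k fixed (suc u)))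
  second = map (id₃ ⊕_) (map (rotate₃ ⊕_) (swapsOf k fixed (suc u)))
  halves : All (Splits π τ r (6 + k * 2)) (first ++ second)
  halves = All.++⁺
    (All.map⁺ (All.map⁺ (All.map (splits-⊕ id₃ rotate₃ rotate₃ _ ∘ splits-⊕ id₃ rotate₃ id₃ _)
      (swapsOf-split k fixed (suc u)))))
    (All.map⁺ (All.map⁺ (All.map (splits-⊕ id₃ rotate₃ id₃ _ ∘ splits-⊕ id₃ rotate₃ rotate₃ _)
      (swapsOf-split k fixed (suc u)))))
  far : hamming π τ ≡ r * 2
  far = trans (hamming-⊕ id₃ rotate₃ (id₃ ⊕ unswapped k fixed) (rotate₃ ⊕ swapped k fixed))
    (cong (3 +_) (trans (hamming-⊕ id₃ rotate₃ (unswapped k fixed) (swapped k fixed))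
      (cong (3 +_) (hamming-unswapped-swapped k fixed))))
  lengths : length (first ++ second) ≡ 2 * (k C suc u)
  lengths = trans (length-++ first) (cong₂ _+_ (twice rotate₃ id₃)
    (trans (twice id₃ rotate₃) (sym (+-identityʳ _))))
    where
    twice : ∀ (p q : Vec (Fin 3) 3) → length (map (p ⊕_) (map (q ⊕_) (swapsOf k fixed (suc u)))) ≡ k C suc u
    twice p q = trans (length-map (p ⊕_) (map (q ⊕_) (swapsOf k fixed (suc u))))
      (trans (length-map (q ⊕_) (swapsOf k fixed (suc u))) (length-swapsOf k fixed (suc u)))
  lower : 2 * (k C suc u) ≤ N (r * 2 + fixed) (r * 2) r
  lower = ≤-trans (≤-reflexive (sym lengths))
    (N-≥ π τ
      (distinct-⊕ id₃ (id₃ ⊕ unswapped k fixed) _ (distinct-⊕ id₃ (unswapped k fixed) _ (distinct-unswapped k fixed)))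
      (distinct-⊕ rotate₃ (rotate₃ ⊕ swapped k fixed) _ (distinct-⊕ rotate₃ (swapped k fixed) _ (distinct-swapped k fixed)))
      far
      (++-⊕-unique (λ ()) (map-⊕-unique id₃ (swapsOf-unique k fixed (suc u)))
                          (map-⊕-unique rotate₃ (swapsOf-unique k fixed (suc u))))
      (subst (λ y → All (Splits π τ r y) (first ++ second)) (n*2≡n+n r) halves))

theorem1 : (t : ℕ) → 2 ≤ t → (n : ℕ)
    → (2 * (2 * t) ≤ n → N n (2 * (2 * t)) (2 * t) ≡ (2 * t) C t)
    × (2 * (2 * t + 1) ≤ n → N n (2 * (2 * t + 1)) (2 * t + 1) ≡ 2 * ((2 * t ∸ 2) C (t ∸ 1)))
theorem1 (suc zero) (s≤s ()) n
theorem1 t@(suc (suc u)) _ n =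
    -- Only commutativity is left: both cases were proved with the factor 2 on the right, where
    -- products unfold along the constructors of `t`.
    subst (λ k → 2 * k ≤ n → N n (2 * k) k ≡ k C t) (*-comm t 2)
      (subst (λ d → d ≤ n → N n d (t * 2) ≡ (t * 2) C t) (*-comm (t * 2) 2) (N-even t n))
  , subst (λ k → 2 * (k + 1) ≤ n → N n (2 * (k + 1)) (k + 1) ≡ 2 * ((k ∸ 2) C suc u)) (*-comm t 2)
      (subst (λ r → 2 * r ≤ n → N n (2 * r) r ≡ 2 * ((suc u * 2) C suc u)) (+-comm 1 (t * 2))
        (subst (λ d → d ≤ n → N n d (1 + t * 2) ≡ 2 * ((suc u * 2) C suc u)) (*-comm (1 + t * 2) 2)
          (N-odd u n)))
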